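{- Let $n\ge5$ and let $C=(1,c_2,\dots,c_{n-1},2c_{n-1}-c_2)$ be a system with $n$ coin types, with subsystem $C'=(1,c_2,\dots,c_{n-1})$. Then $C$ is canonical and $C'$ is noncanonical if and only if $C=(1,2,\dots,n-3,c_{n-2},c_{n-2}+1,2c_{n-2})$ and $c_{n-2}>n-2$.
   Context: A system is a tuple $C=(c_1,\dots,c_n)$ of integers with $1=c_1<c_2<\dots<c_n$; for $k\le n$, $(c_1,\dots,c_k)$ is a subsystem. For a positive integer $v$, $\mathrm{opt}_C(v)$ is the minimum of $\sum_i x_i$ over $x\in\mathbb{Z}_{\ge0}^n$ with $\sum_i c_ix_i=v$. The greedy representation of $v$ is produced by: for $i=n$ down to $1$, while $c_i\le$ remaining value, take a coin $c_i$. $\mathrm{grd}_C(v)$ is its number of coins. A positive integer $w$ is a counterexample if $\mathrm{opt}_C(w)<\mathrm{grd}_C(w)$; $C$ is canonical if it has none, noncanonical otherwise. -}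

module Defs where

open import Algebra.Properties.Monoid.Sum using ()
open import Data.Empty using (⊥)
open import Data.Fin as Fin using (Fin; zero; suc; inject₁)
open import Data.Fin.Properties using (toℕ-inject₁)
open import Data.Nat using (ℕ; zero; suc; _+_; _*_; _∸_; _≤_; _<_; _>_; s≤s; z≤n; s≤s⁻¹; z<s; NonZero; >-nonZero)
open import Data.Nat.DivMod using (_/_; _%_)
open import Data.Nat.Induction using (<-rec)
open import Data.Nat.Properties
open import Data.Product using (∃-syntax; _×_; _,_; proj₁; proj₂)
open import Data.Vec.Functional using (Vector; []; _∷_; head; tail; init; last)
open import Function using (_∘_; const)
open import Relation.Binary.PropositionalEquality using (_≡_; refl; sym; trans; cong; cong₂; subst; subst₂)
open import Relation.Nullary using (¬_; Dec; yes; no)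
open import Relation.Nullary.Decidable using (_×-dec_)

open Algebra.Properties.Monoid.Sum +-0-monoid public using (sum; sum-syntax)

private
  variable
    n : ℕ

-- The i-th coin c_i of a tuple (c_1, …, c_n) is c at the index i - 1 of Fin n.

IsSystem : Vector ℕ n → Set
IsSystem {zero}  c = ⊥
IsSystem {suc n} c = c zero ≡ 1 × (∀ {i j} → i Fin.< j → c i < c j)

record System (n : ℕ) : Set where
  constructor system
  field
    coin     : Vector ℕ n
    isSystem : IsSystem coin

open System public

-- (c_1, …, c_{n-1}) from (c_1, …, c_n), for n ≥ 2.
initSubsystem : System (suc (suc n)) → System (suc n)
initSubsystem (system c (c₁≡1 , c-mono)) =
  system (c ∘ inject₁)
    ( c₁≡1
    , λ {i} {j} i<j → c-mono (subst₂ _<_ (sym (toℕ-inject₁ i)) (sym (toℕ-inject₁ j)) i<j))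

value : Vector ℕ n → Vector ℕ n → ℕ
value {n} c x = ∑[ i < n ] (c i * x i)

Attains : Vector ℕ n → ℕ → ℕ → Set
Attains {n} c v k = ∃[ x ] (value {n} c x ≡ v × sum x ≡ k)

IsOptimum : Vector ℕ n → ℕ → ℕ → Set
IsOptimum {n} c v k = Attains c v k × (∀ (x : Vector ℕ n) → value c x ≡ v → k ≤ sum x)

attains? : (c : Vector ℕ n) (v k : ℕ) → Dec (Attains c v k)
attains? {zero} c v k with 0 ≟ v | 0 ≟ k
... | yes p | yes q = yes ([] , p , q)
... | no ¬p | _     = no λ (_ , p , _) → ¬p p
... | _     | no ¬q = no λ (_ , _ , q) → ¬q q
attains? {suc n} c v k
  with anyUpTo? (λ a → (head c * a ≤? v) ×-dec attains? (tail c) (v ∸ head c * a) (k ∸ a)) (suc k)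
... | yes (a , a<1+k , ca≤v , x , p , q) =
      yes ( a ∷ x
          , trans (cong (head c * a +_) p) (m+[n∸m]≡n ca≤v)
          , trans (cong (a +_) q) (m+[n∸m]≡n (s≤s⁻¹ a<1+k)) )
... | no ¬e = no λ where
      (x , refl , refl) → ¬e
        ( head x
        , s≤s (m≤m+n (head x) _)
        , m≤m+n (head c * head x) _
        , tail x
        , sym (m+n∸m≡n (head c * head x) _)
        , sym (m+n∸m≡n (head x) _) )

least-attained : (c : Vector ℕ n) (v k : ℕ) → Attains c v k → ∃[ m ] IsOptimum c v m
least-attained c v = <-rec (λ k → Attains c v k → ∃[ m ] IsOptimum c v m) step
  where
  step : ∀ k → (∀ {j} → j < k → Attains c v j → ∃[ m ] IsOptimum c v m) →
         Attains c v k → ∃[ m ] IsOptimum c v m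
  step k rec att with anyUpTo? (attains? c v) k
  ... | yes (j , j<k , att′) = rec j<k att′
  ... | no ¬e = k , att , λ x p → ≮⇒≥ λ lt → ¬e (sum x , lt , x , p , refl)

private
  value-0 : (c : Vector ℕ n) → value c (const 0) ≡ 0
  value-0 {zero}  c = refl
  value-0 {suc n} c = cong₂ _+_ (*-zeroʳ (head c)) (value-0 (tail c))

attainable : (C : System n) (v : ℕ) → ∃[ k ] Attains (coin C) v k
attainable {suc n} (system c (c₁≡1 , _)) v = sum {suc n} (v ∷ const 0) , (v ∷ const 0) ,
  trans (cong₂ _+_ (trans (cong (_* v) c₁≡1) (*-identityˡ v)) (value-0 (tail c))) (+-identityʳ v) ,
  refl

optimum : (C : System n) (v : ℕ) → ∃[ m ] IsOptimum (coin C) v m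
optimum C v = least-attained (coin C) v (proj₁ (attainable C v)) (proj₂ (attainable C v))

opt : System n → ℕ → ℕ
opt C v = proj₁ (optimum C v)

opt-isOptimum : (C : System n) (v : ℕ) → IsOptimum (coin C) v (opt C v)
opt-isOptimum C v = proj₂ (optimum C v)

coin-positive : (C : System n) (i : Fin n) → coin C i > 0
coin-positive {suc n} (system c (c₁≡1 , _))      zero    = subst (_> 0) (sym c₁≡1) z<s
coin-positive {suc n} (system c (c₁≡1 , c-mono)) (suc i) = ≤-<-trans z≤n (c-mono {zero} {suc i} z<s)

-- The loop "while c ≤ r, take a coin c and put r := r - c" takes r / c coins and
-- leaves r % c; the largest coin comes first.
greedyCount : (c : Vector ℕ n) → (∀ i → c i > 0) → ℕ → ℕ
greedyCount {zero}  c c>0 r = 0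
greedyCount {suc n} c c>0 r = r / last c + greedyCount (init c) (c>0 ∘ inject₁) (r % last c)
  where instance
    last≢0 : NonZero (last c)
    last≢0 = >-nonZero (c>0 _)

grd : System n → ℕ → ℕ
grd C = greedyCount (coin C) (coin-positive C)

Counterexample : System n → ℕ → Set
Counterexample C w = w > 0 × opt C w < grd C w

Canonical : System n → Set
Canonical C = ¬ (∃[ w ] Counterexample C w)

Noncanonical : System n → Set
Noncanonical C = ¬ Canonical C

{-# OPTIONS --safe #-}
-- Write a = c₂, p = c_{n-2}, q = c_{n-1}, r = c_n = 2q − a.  A system is canonical iff
-- grd (c + v) ≤ 1 + grd v for all coins c and all v, and it is enough to check v below
-- the largest coin.  Below r the greedy counts of C and C′ agree, so if C is canonical
-- and C′ is not, some c + v with c ≤ p and v < q reaches r, whence q < p + a.  Then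
-- p + q = r + (p + a − q) must be greedily paid with two coins, which forces
-- q = p + a − 1, and C′ fails exactly when grd (p − 1) > a − 1.  If a > 2, then
-- 2p = q + (p − a + 1) makes p − a + 1 a coin, and p − 1 is paid with a − 1 coins, a
-- contradiction.  If a = 2, then t + p = q + (t − 1) shows that with t also t − 1 is a
-- coin, so the coins below p are 1, 2, …, n − 3, and p − 1 is not among them.
-- Conversely, the greedy count of (1, …, k, p, p + 1, 2p) is explicit enough to check
-- the criterion, and C′ fails at 2p = p + p.
module Submission where

open import Defs
open import Algebra.Properties.CommutativeSemigroup using (x∙yz≈y∙xz)
open import Data.Fin as Fin using (Fin; zero; suc; inject₁; fromℕ; fromℕ<; toℕ; opposite)
open import Data.Fin.Induction using (<-weakInduction)
open import Data.Fin.Properties using (toℕ-injective; ≤fromℕ; toℕ-inject₁; toℕ-fromℕ; toℕ-fromℕ<)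
open import Data.Fin.Relation.Unary.Top using (view; ‵fromℕ; ‵inj₁)
open import Data.List using (List; []; _∷_; _++_; _∷ʳ_; applyUpTo; tabulate)
open import Data.List.Properties using (∷-injective; ∷ʳ-++; ∷ʳ-injective)
open import Data.Nat
open import Data.Nat.DivMod using (_/_; _%_; m/n≡1+[m∸n]/n; m≤n⇒[n∸m]%m≡n%m; m<n⇒m/n≡0; m<n⇒m%n≡m; 0/n≡0)
open import Data.Nat.Induction using (<-rec)
open import Data.Nat.Properties
open import Data.Nat.Solver using (module +-*-Solver)
open import Data.Product using (∃-syntax; _×_; _,_; proj₁; proj₂)
open import Data.Sum using (inj₁; inj₂; [_,_]′)
open import Data.Vec.Functional using (Vector; toList; updateAt; head; tail; init; last)
open import Function using (_∘_; const)
open import Function.Bundles using (_⇔_; mk⇔)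
open import Relation.Binary.PropositionalEquality
open import Relation.Nullary using (yes; no; contradiction)

private
  variable
    n : ℕ

-- Reading a tuple of coins from its end

toList-∷ʳ : {A : Set} (f : Vector A (suc n)) → toList f ≡ toList (init f) ∷ʳ last f
toList-∷ʳ {zero}  f = refl
toList-∷ʳ {suc n} f = cong (head f ∷_) (toList-∷ʳ (tail f))

tabulate≡applyUpTo : {A : Set} (f : Fin n → A) (g : ℕ → A) →
  (∀ i → f i ≡ g (toℕ i)) → tabulate f ≡ applyUpTo g n
tabulate≡applyUpTo {zero}  f g f≗g = refl
tabulate≡applyUpTo {suc n} f g f≗g =
  cong₂ _∷_ (f≗g zero) (tabulate≡applyUpTo (f ∘ suc) (g ∘ suc) (f≗g ∘ suc))

tabulate≡applyUpTo⁻¹ : {A : Set} (f : Fin n → A) (g : ℕ → A) →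
  tabulate f ≡ applyUpTo g n → ∀ i → f i ≡ g (toℕ i)
tabulate≡applyUpTo⁻¹ f g eq zero    = proj₁ (∷-injective eq)
tabulate≡applyUpTo⁻¹ f g eq (suc i) =
  tabulate≡applyUpTo⁻¹ (f ∘ suc) (g ∘ suc) (proj₂ (∷-injective eq)) i

∷ʳ³-++ : {A : Set} (xs : List A) (x y z : A) →
  xs ∷ʳ x ∷ʳ y ∷ʳ z ≡ xs ++ x ∷ y ∷ z ∷ []
∷ʳ³-++ xs x y z = trans (∷ʳ-++ (xs ∷ʳ x) y (z ∷ [])) (∷ʳ-++ xs x (y ∷ z ∷ []))

inject₁-fromℕ-elim : (P : Fin (suc n) → Set) →
  P (fromℕ n) → (∀ i → P (inject₁ i)) → ∀ i → P i
inject₁-fromℕ-elim P top inj i with view i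
... | ‵fromℕ = top
... | ‵inj₁ {i = j} _ = inj j

-- Systems

module _ (C : System (suc n)) where

  topCoin : ℕ
  topCoin = last (coin C)

  coin-mono-< : ∀ {i j} → i Fin.< j → coin C i < coin C j
  coin-mono-< = proj₂ (isSystem C)

  coin-mono-≤ : ∀ {i j} → i Fin.≤ j → coin C i ≤ coin C j
  coin-mono-≤ {i} {j} i≤j with m≤n⇒m<n∨m≡n i≤j
  ... | inj₁ i<j = <⇒≤ (coin-mono-< i<j)
  ... | inj₂ i≡j = ≤-reflexive (cong (coin C) (toℕ-injective i≡j))

  coin-cancel-< : ∀ {i j} → coin C i < coin C j → i Fin.< j
  coin-cancel-< ci<cj = ≰⇒> λ j≤i → <⇒≱ ci<cj (coin-mono-≤ j≤i)

  coin≤topCoin : ∀ i → coin C i ≤ topCoin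
  coin≤topCoin i = coin-mono-≤ (≤fromℕ i)

topCoin-initSubsystem-< : (C : System (suc (suc n))) → topCoin (initSubsystem C) < topCoin C
topCoin-initSubsystem-< {n} C = coin-mono-< C (s≤s (≤-reflexive (toℕ-inject₁ (fromℕ n))))

-- The greedy count

-- The positivity proof that `coin-positive` gives for `initSubsystem C` and the one restricted from
-- `C` are different terms; the count has to be freed from this choice.
greedyCount-irrelevant : (c : Vector ℕ n) (c>0 c>0′ : ∀ i → c i > 0) (v : ℕ) →
  greedyCount c c>0 v ≡ greedyCount c c>0′ v
greedyCount-irrelevant {zero}  c c>0 c>0′ v = refl
greedyCount-irrelevant {suc n} c c>0 c>0′ v =
  cong (v / last c +_)
    (greedyCount-irrelevant (init c) (c>0 ∘ inject₁) (c>0′ ∘ inject₁) (v % last c))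
  where instance
    last≢0 : NonZero (last c)
    last≢0 = >-nonZero (c>0 _)

greedyCount-0 : (c : Vector ℕ n) (c>0 : ∀ i → c i > 0) → greedyCount c c>0 0 ≡ 0
greedyCount-0 {zero}  c c>0 = refl
greedyCount-0 {suc n} c c>0 = cong₂ _+_ (0/n≡0 (last c))
  (trans (cong (greedyCount (init c) (c>0 ∘ inject₁)) (m<n⇒m%n≡m (c>0 _)))
         (greedyCount-0 (init c) (c>0 ∘ inject₁)))
  where instance
    last≢0 : NonZero (last c)
    last≢0 = >-nonZero (c>0 _)

greedyCount-last-+ : (c : Vector ℕ (suc n)) (c>0 : ∀ i → c i > 0) (v : ℕ) →
  greedyCount c c>0 (last c + v) ≡ suc (greedyCount c c>0 v)
greedyCount-last-+ c c>0 v = cong₂ (λ a b → a + greedyCount (init c) (c>0 ∘ inject₁) b)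
  (trans (m/n≡1+[m∸n]/n (m≤m+n (last c) v)) (cong (λ u → suc (u / last c)) (m+n∸m≡n (last c) v)))
  (trans (sym (m≤n⇒[n∸m]%m≡n%m (m≤m+n (last c) v))) (cong (_% last c) (m+n∸m≡n (last c) v)))
  where instance
    last≢0 : NonZero (last c)
    last≢0 = >-nonZero (c>0 _)

greedyCount-init : (c : Vector ℕ (suc n)) (c>0 : ∀ i → c i > 0) {v : ℕ} → v < last c →
  greedyCount c c>0 v ≡ greedyCount (init c) (c>0 ∘ inject₁) v
greedyCount-init c c>0 v<last =
  cong₂ (λ a b → a + greedyCount (init c) (c>0 ∘ inject₁) b) (m<n⇒m/n≡0 v<last) (m<n⇒m%n≡m v<last)
  where instance
    last≢0 : NonZero (last c)
    last≢0 = >-nonZero (c>0 _)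

grd-0 : (C : System n) → grd C 0 ≡ 0
grd-0 C = greedyCount-0 (coin C) (coin-positive C)

grd-topCoin-+ : (C : System (suc n)) (v : ℕ) → grd C (topCoin C + v) ≡ suc (grd C v)
grd-topCoin-+ C = greedyCount-last-+ (coin C) (coin-positive C)

grd-initSubsystem : (C : System (suc (suc n))) {v : ℕ} → v < topCoin C →
  grd C v ≡ grd (initSubsystem C) v
grd-initSubsystem C {v} v<top = trans
  (greedyCount-init (coin C) (coin-positive C) v<top)
  (greedyCount-irrelevant (init (coin C)) (coin-positive C ∘ inject₁) (coin-positive (initSubsystem C)) v)

-- A greedy payment arises from 0 by adding coins one at a time, so a relation between value and
-- count that survives adding any coin holds of it. The recursion passes to the subsystem below the
-- top coin and to a smaller value otherwise.
grd-induction : (C : System (suc n)) (P : ℕ → ℕ → Set) → P 0 0 →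
  (∀ i {v k} → P v k → P (coin C i + v) (suc k)) → ∀ v → P v (grd C v)
grd-induction {n} C P P0 step = <-rec (λ v → P v (grd C v)) go
  where
  below : ∀ {m} (C : System (suc m)) → (∀ i {v k} → P v k → P (coin C i + v) (suc k)) →
          ∀ {v} → v < topCoin C → P v (grd C v)
  -- The top coin of a one-coin system is 1, so only the value 0 lies below it.
  below {zero} C step v<top with s≤s z≤n ← subst (_ <_) (proj₁ (isSystem C)) v<top =
    subst (P 0) (sym (grd-0 C)) P0
  below {suc m} C step v<top = subst (P _) (sym (grd-initSubsystem C v<top))
    (grd-induction (initSubsystem C) P P0 (step ∘ inject₁) _)
  go : ∀ v → (∀ {u} → u < v → P u (grd C u)) → P v (grd C v)
  go v rec with topCoin C ≤? v
  ... | no top≰v = below C step (≰⇒> top≰v)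
  ... | yes top≤v with u , refl ← m≤n⇒∃[o]m+o≡n top≤v =
    subst (P _) (sym (grd-topCoin-+ C u))
      (step (fromℕ n) (rec (m<n+m u (coin-positive C (fromℕ n)))))

grd≤ : (C : System (suc n)) (v : ℕ) → grd C v ≤ v
grd≤ C = grd-induction C (λ v k → k ≤ v) z≤n
  (λ i → +-mono-≤ (coin-positive C i))

-- Below the second coin only the unit coin is available.
≤grd : (C : System (suc (suc n))) {v : ℕ} → v < coin C (suc zero) → v ≤ grd C v
≤grd C {v} = grd-induction C (λ v k → v < coin C (suc zero) → v ≤ k) (λ _ → z≤n) step v
  where
  step : ∀ i {v k} → (v < coin C (suc zero) → v ≤ k) →
         coin C i + v < coin C (suc zero) → coin C i + v ≤ suc k
  step zero    rec lt rewrite proj₁ (isSystem C) = s≤s (rec (<⇒≤ lt))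
  step (suc i) rec lt = contradiction (≤-trans (coin-mono-≤ C (s≤s z≤n)) (m≤m+n _ _)) (<⇒≱ lt)

grd≤1⇒coin : (C : System (suc n)) {v : ℕ} → v > 0 → grd C v ≤ 1 → ∃[ i ] coin C i ≡ v
grd≤1⇒coin C {v} v>0 = proj₂ (grd-induction C P P0 step v) v>0
  where
  P : ℕ → ℕ → Set
  -- The first conjunct strengthens the induction: before the single coin is added, count 0 has to
  -- force value 0.
  P v k = (k ≤ 0 → v ≡ 0) × (v > 0 → k ≤ 1 → ∃[ i ] coin C i ≡ v)
  P0 : P 0 0
  P0 = (λ _ → refl) , λ ()
  step : ∀ i {v k} → P v k → P (coin C i + v) (suc k)
  step i (v≡0 , _) = (λ ()) ,
    λ _ k≤1 → i , sym (trans (cong (coin C i +_) (v≡0 (s≤s⁻¹ k≤1))) (+-identityʳ _))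

grd-coin : (C : System (suc n)) (i : Fin (suc n)) → grd C (coin C i) ≡ 1
grd-coin {n} C = inject₁-fromℕ-elim (λ i → grd C (coin C i) ≡ 1)
  (trans (cong (grd C) (sym (+-identityʳ _)))
         (trans (grd-topCoin-+ C 0) (cong suc (grd-0 C))))
  (inner C)
  where
  inner : ∀ {n} (C : System (suc n)) i → grd C (coin C (inject₁ i)) ≡ 1
  inner {suc n} C i = trans
    (grd-initSubsystem C (≤-<-trans (coin≤topCoin (initSubsystem C) i) (topCoin-initSubsystem-< C)))
    (grd-coin (initSubsystem C) i)

grd-positive : (C : System (suc n)) {v : ℕ} → v > 0 → grd C v > 0
grd-positive C {v} =
  grd-induction C (λ v k → v > 0 → k > 0) (λ ()) (λ _ _ _ → z<s) v

-- Canonicity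

sum-const-0 : ∀ n → sum {n} (const 0) ≡ 0
sum-const-0 zero    = refl
sum-const-0 (suc n) = sum-const-0 n

value-const-0 : (c : Vector ℕ n) → value c (const 0) ≡ 0
value-const-0 {zero}  c = refl
value-const-0 {suc n} c = cong₂ _+_ (*-zeroʳ (head c)) (value-const-0 (tail c))

sum-updateAt-suc : (x : Vector ℕ n) (i : Fin n) → sum (updateAt x i suc) ≡ suc (sum x)
sum-updateAt-suc x zero    = refl
sum-updateAt-suc x (suc i) =
  trans (cong (head x +_) (sum-updateAt-suc (tail x) i)) (+-suc (head x) _)

value-updateAt-suc : (c x : Vector ℕ n) (i : Fin n) →
  value c (updateAt x i suc) ≡ c i + value c x
value-updateAt-suc c x zero    =
  trans (cong (_+ value (tail c) (tail x)) (*-suc (head c) (head x))) (+-assoc (head c) _ _)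
value-updateAt-suc c x (suc i) =
  trans (cong (head c * head x +_) (value-updateAt-suc (tail c) (tail x) i))
        (x∙yz≈y∙xz +-commutativeSemigroup (head c * head x) (c (suc i)) _)

Attains-coin-+ : (c : Vector ℕ n) (i : Fin n) {v k : ℕ} →
  Attains c v k → Attains c (c i + v) (suc k)
Attains-coin-+ c i (x , refl , refl) =
  updateAt x i suc , value-updateAt-suc c x i , sum-updateAt-suc x i

Attains-grd : (C : System (suc n)) (v : ℕ) → Attains (coin C) v (grd C v)
Attains-grd {n} C = grd-induction C (Attains (coin C))
  (const 0 , value-const-0 (coin C) , sum-const-0 n) (Attains-coin-+ (coin C))

-- Stripping off the coins of `x` one by one lowers `g` by at most 1 each time. `g` is arbitrary
-- because the induction passes to `tail c`, whose own greedy count is a different function.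
subadditive⇒≤sum : (g : ℕ → ℕ) (c : Vector ℕ n) → (∀ i v → g (c i + v) ≤ suc (g v)) →
  ∀ x v → g (value c x + v) ≤ sum x + g v
subadditive⇒≤sum {zero}  g c sub x v = ≤-refl
subadditive⇒≤sum {suc n} g c sub x v = begin
  g (c₀ * x₀ + V + v)   ≡⟨ cong g (+-assoc (c₀ * x₀) V v) ⟩
  g (c₀ * x₀ + (V + v)) ≤⟨ repeat x₀ (V + v) ⟩
  x₀ + g (V + v)        ≤⟨ +-monoʳ-≤ x₀ (subadditive⇒≤sum g (tail c) (sub ∘ suc) (tail x) v) ⟩
  x₀ + (S + g v)        ≡⟨ +-assoc x₀ S (g v) ⟨
  x₀ + S + g v          ∎
  where
  open ≤-Reasoning
  c₀ = head c
  x₀ = head x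
  V = value (tail c) (tail x)
  S = sum (tail x)
  repeat : ∀ k u → g (c₀ * k + u) ≤ k + g u
  repeat zero    u = ≤-reflexive (cong (λ z → g (z + u)) (*-zeroʳ c₀))
  repeat (suc k) u = begin
    g (c₀ * suc k + u)    ≡⟨ cong (λ z → g (z + u)) (*-suc c₀ k) ⟩
    g (c₀ + c₀ * k + u)   ≡⟨ cong g (+-assoc c₀ (c₀ * k) u) ⟩
    g (c₀ + (c₀ * k + u)) ≤⟨ sub zero (c₀ * k + u) ⟩
    suc (g (c₀ * k + u))  ≤⟨ s≤s (repeat k u) ⟩
    suc (k + g u)         ∎

-- One coin added to the greedy representation of `v` represents the sum with `suc (grd C v)` coins,
-- and in a canonical system no representation beats the greedy one.
canonical⇒subadditive : (C : System (suc n)) → Canonical C →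
  ∀ i v → grd C (coin C i + v) ≤ suc (grd C v)
canonical⇒subadditive C can i v
  with x , val , cnt ← Attains-coin-+ (coin C) i (Attains-grd C v) = begin
  grd C w       ≤⟨ ≮⇒≥ (λ opt<grd → can (w , w>0 , opt<grd)) ⟩
  opt C w       ≤⟨ proj₂ (opt-isOptimum C w) x val ⟩
  sum x         ≡⟨ cnt ⟩
  suc (grd C v) ∎
  where
  open ≤-Reasoning
  w = coin C i + v
  w>0 : w > 0
  w>0 = ≤-trans (coin-positive C i) (m≤m+n _ v)

-- Applied to an optimal representation with nothing left over, subadditivity bounds `grd` by the
-- optimum.
subadditive⇒canonical : (C : System (suc n)) →
  (∀ i v → grd C (coin C i + v) ≤ suc (grd C v)) → Canonical C
subadditive⇒canonical C sub (w , _ , opt<grd) with proj₁ (opt-isOptimum C w)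
... | x , val , cnt = <⇒≱ opt<grd (begin
  grd C w                         ≡⟨ cong (grd C) (trans (+-identityʳ _) val) ⟨
  grd C (value (coin C) x + 0)    ≤⟨ subadditive⇒≤sum (grd C) (coin C) sub x 0 ⟩
  sum x + grd C 0                 ≡⟨ cong₂ _+_ cnt (grd-0 C) ⟩
  opt C w + 0                     ≡⟨ +-identityʳ _ ⟩
  opt C w                         ∎)
  where open ≤-Reasoning

-- A top coin contained in v splits off on both sides, so subadditivity only has to
-- be checked for v below the top coin.
canonical-criterion : (C : System (suc n)) →
  (∀ i v → v < topCoin C → grd C (coin C (inject₁ i) + v) ≤ suc (grd C v)) → Canonical C
canonical-criterion {n} C small = subadditive⇒canonical C λ i v →
  <-rec (λ v → ∀ i → grd C (coin C i + v) ≤ suc (grd C v)) go v i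
  where
  go : ∀ v → (∀ {u} → u < v → ∀ i → grd C (coin C i + u) ≤ suc (grd C u)) →
       ∀ i → grd C (coin C i + v) ≤ suc (grd C v)
  go v rec i with topCoin C ≤? v
  ... | yes top≤v with u , refl ← m≤n⇒∃[o]m+o≡n top≤v = begin
    grd C (coin C i + (topCoin C + u)) ≡⟨ cong (grd C) (x∙yz≈y∙xz +-commutativeSemigroup (coin C i) (topCoin C) u) ⟩
    grd C (topCoin C + (coin C i + u)) ≡⟨ grd-topCoin-+ C _ ⟩
    suc (grd C (coin C i + u))         ≤⟨ s≤s (rec (m<n+m u (coin-positive C (fromℕ n))) i) ⟩
    suc (suc (grd C u))                ≡⟨ cong suc (grd-topCoin-+ C u) ⟨
    suc (grd C (topCoin C + u))        ∎
    where open ≤-Reasoning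
  -- Adding the top coin raises the count by exactly one, so only the other coins call on `small`.
  ... | no top≰v = inject₁-fromℕ-elim (λ i → grd C (coin C i + v) ≤ suc (grd C v))
    (≤-reflexive (grd-topCoin-+ C v)) (λ j → small j v (≰⇒> top≰v)) i

-- Necessity of the shape

-- Once the greedy algorithm has taken its first coin from such a sum, at most one coin remains.
-- This is how certain differences are recognised as coins.
canonical⇒grd-pair≤2 : (C : System (suc n)) → Canonical C →
  ∀ i j → grd C (coin C i + coin C j) ≤ 2
canonical⇒grd-pair≤2 C can i j =
  ≤-trans (canonical⇒subadditive C can i _) (s≤s (≤-reflexive (grd-coin C j)))

module Forward {m : ℕ} (C : System (5 + m))
  (r≡2q∸a : topCoin C ≡ 2 * topCoin (initSubsystem C) ∸ coin C (suc zero))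
  (can : Canonical C) (non : Noncanonical (initSubsystem C)) where

  C′ = initSubsystem C
  C″ = initSubsystem C′
  C‴ = initSubsystem C″

  a = coin C (suc zero)
  p = topCoin C″
  q = topCoin C′
  r = topCoin C

  -- `opposite` unfolds to `inject₁` and `fromℕ`, so `coin C` takes the values `p` at `iₚ` and `q`
  -- at `iq` by definition.
  iₚ : Fin (5 + m)
  iₚ = opposite (suc (suc zero))

  iq : Fin (5 + m)
  iq = opposite (suc zero)

  sub = canonical⇒subadditive C can
  pair≤2 = canonical⇒grd-pair≤2 C can

  p<q : p < q
  p<q = topCoin-initSubsystem-< C′

  q<r : q < r
  q<r = topCoin-initSubsystem-< C

  a<p : a < p
  a<p = coin-mono-< C″ (s≤s (s≤s z≤n))

  r+a≡q+q : r + a ≡ q + q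
  r+a≡q+q = begin
    r + a         ≡⟨ cong (_+ a) r≡2q∸a ⟩
    2 * q ∸ a + a ≡⟨ m∸n+n≡m (≤-trans (<⇒≤ (<-trans a<p p<q)) (m≤m+n q _)) ⟩
    2 * q         ≡⟨ cong (q +_) (+-identityʳ q) ⟩
    q + q         ∎
    where open ≡-Reasoning

  sub′-below : ∀ i v → coin C′ i + v < r → grd C′ (coin C′ i + v) ≤ suc (grd C′ v)
  sub′-below i v lt = subst₂ (λ x y → x ≤ suc y) (grd-initSubsystem C lt)
    (grd-initSubsystem C (≤-<-trans (m≤n+m v _) lt)) (sub (inject₁ i) v)

  -- If `p + a ≤ q`, then `r + a = 2q` gives `p + q ≤ r`. All sums that the criterion tests on `C′`
  -- then stay below `r`, where `C′` inherits subadditivity from `C`.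
  q<p+a : q < p + a
  q<p+a = ≰⇒> λ p+a≤q → non (canonical-criterion C′ λ i v v<q →
    sub′-below (inject₁ i) v (<-≤-trans (+-mono-≤-< (coin≤topCoin C″ i) v<q) (p+q≤r p+a≤q)))
    where
    p+q≤r : p + a ≤ q → p + q ≤ r
    p+q≤r p+a≤q = +-cancelʳ-≤ a _ _ (begin
      p + q + a ≡⟨ solve 3 (λ p q a → p :+ q :+ a := p :+ a :+ q) refl p q a ⟩
      p + a + q ≤⟨ +-monoˡ-≤ q p+a≤q ⟩
      q + q     ≡⟨ r+a≡q+q ⟨
      r + a     ∎)
      where
      open ≤-Reasoning
      open +-*-Solver

  -- p + q = r + (p + a − q), so p + a − q is a coin below c₂.
  1+q≡p+a : suc q ≡ p + a
  1+q≡p+a = trans (trans (+-comm 1 q) (cong (q +_) (sym e≡1))) e-def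
    where
    open +-*-Solver
    e = p + a ∸ q
    e-def : q + e ≡ p + a
    e-def = m+[n∸m]≡n (<⇒≤ q<p+a)
    p+q≡r+e : p + q ≡ r + e
    p+q≡r+e = +-cancelʳ-≡ a _ _ (begin
      p + q + a   ≡⟨ solve 3 (λ p q a → p :+ q :+ a := p :+ a :+ q) refl p q a ⟩
      p + a + q   ≡⟨ cong (_+ q) e-def ⟨
      q + e + q   ≡⟨ solve 2 (λ q e → q :+ e :+ q := q :+ q :+ e) refl q e ⟩
      q + q + e   ≡⟨ cong (_+ e) r+a≡q+q ⟨
      r + a + e   ≡⟨ solve 3 (λ r a e → r :+ a :+ e := r :+ e :+ a) refl r a e ⟩
      r + e + a   ∎)
      where open ≡-Reasoning
    grd-e≤1 : grd C e ≤ 1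
    grd-e≤1 = s≤s⁻¹ (begin
      suc (grd C e) ≡⟨ grd-topCoin-+ C e ⟨
      grd C (r + e) ≡⟨ cong (grd C) p+q≡r+e ⟨
      grd C (p + q) ≤⟨ pair≤2 iₚ iq ⟩
      2             ∎)
      where open ≤-Reasoning
    e<a : e < a
    e<a = +-cancelˡ-< p e a (subst (p + e <_) e-def (+-monoˡ-< e p<q))
    unit : ∃[ i ] coin C i ≡ e → e ≡ 1
    unit (zero  , c≡e) = trans (sym c≡e) (proj₁ (isSystem C))
    unit (suc j , c≡e) = contradiction (subst (a ≤_) c≡e (coin-mono-≤ C (s≤s z≤n))) (<⇒≱ e<a)
    e≡1 : e ≡ 1
    e≡1 = unit (grd≤1⇒coin C (m<n⇒0<n∸m q<p+a) grd-e≤1)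

  -- These shifts replace differences by sums: `q = p + a₁ + 1` and `r = q + p₀ = 2p + a₁`.
  a₁ = a ∸ 2
  p₀ = p ∸ 1

  a≡2+a₁ : a ≡ suc (suc a₁)
  a≡2+a₁ = sym (m+[n∸m]≡n (subst (_< a) (proj₁ (isSystem C)) (coin-mono-< C (s≤s z≤n))))

  p≡1+p₀ : p ≡ suc p₀
  p≡1+p₀ = sym (m+[n∸m]≡n (≤-trans (s≤s z≤n) a<p))

  q≡1+p+a₁ : q ≡ suc (p + a₁)
  q≡1+p+a₁ = suc-injective (trans 1+q≡p+a (trans (cong (p +_) a≡2+a₁)
    (solve 2 (λ p x → p :+ (con 2 :+ x) := con 2 :+ (p :+ x)) refl p a₁)))
    where open +-*-Solver

  r≡q+p₀ : r ≡ q + p₀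
  r≡q+p₀ = +-cancelʳ-≡ a _ _ (begin
    r + a          ≡⟨ r+a≡q+q ⟩
    q + q          ≡⟨ cong (q +_) (suc-injective (trans 1+q≡p+a (cong (_+ a) p≡1+p₀))) ⟩
    q + (p₀ + a)   ≡⟨ +-assoc q p₀ a ⟨
    q + p₀ + a     ∎)
    where open ≡-Reasoning

  r≡p+[p+a₁] : r ≡ p + (p + a₁)
  r≡p+[p+a₁] = begin
    r                   ≡⟨ r≡q+p₀ ⟩
    q + p₀              ≡⟨ cong (_+ p₀) q≡1+p+a₁ ⟩
    suc (p + a₁ + p₀)   ≡⟨ +-suc (p + a₁) p₀ ⟨
    p + a₁ + suc p₀     ≡⟨ cong (p + a₁ +_) p≡1+p₀ ⟨
    p + a₁ + p          ≡⟨ +-comm (p + a₁) p ⟩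
    p + (p + a₁)        ∎
    where open ≡-Reasoning

  -- The only sum c + v of a coin c ≤ p and a v < q that reaches r is p + (q − 1) = r.
  grd-p₀>1+a₁ : suc a₁ < grd C′ p₀
  grd-p₀>1+a₁ = ≰⇒> λ grd-p₀≤ → non (canonical-criterion C′ (criterion grd-p₀≤))
    where
    -- `p + a₁` is `q − 1`; greedily it costs `p` and then `a₁` units, since `a₁ < a`.
    1+a₁≤grd : suc a₁ ≤ grd C′ (p + a₁)
    1+a₁≤grd = begin
      suc a₁             ≤⟨ s≤s (≤grd C″ (≤-trans (n≤1+n _) (≤-reflexive (sym a≡2+a₁)))) ⟩
      suc (grd C″ a₁)    ≡⟨ grd-topCoin-+ C″ a₁ ⟨
      grd C″ (p + a₁)    ≡⟨ grd-initSubsystem C′ (≤-reflexive (sym q≡1+p+a₁)) ⟨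
      grd C′ (p + a₁)    ∎
      where open ≤-Reasoning
    criterion : grd C′ p₀ ≤ suc a₁ → ∀ i v → v < q →
      grd C′ (coin C′ (inject₁ i) + v) ≤ suc (grd C′ v)
    criterion grd-p₀≤ i v v<q = [ sub′-below (inject₁ i) v , reaches-r ]′ (<-≤-connex (cᵢ + v) r)
      where
      open ≤-Reasoning
      cᵢ = coin C′ (inject₁ i)
      cᵢ≤p : cᵢ ≤ p
      cᵢ≤p = coin≤topCoin C″ i
      v≤p+a₁ : v ≤ p + a₁
      v≤p+a₁ = s≤s⁻¹ (subst (v <_) q≡1+p+a₁ v<q)
      v≡p+a₁ : r ≤ cᵢ + v → v ≡ p + a₁
      v≡p+a₁ r≤ = ≤-antisym v≤p+a₁ (+-cancelˡ-≤ p _ _ (≤-trans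
        (subst (_≤ cᵢ + v) r≡p+[p+a₁] r≤) (+-monoˡ-≤ v cᵢ≤p)))
      cᵢ+v≡r : r ≤ cᵢ + v → cᵢ + v ≡ r
      cᵢ+v≡r = ≤-antisym (subst (cᵢ + v ≤_) (sym r≡p+[p+a₁]) (+-mono-≤ cᵢ≤p v≤p+a₁))
      reaches-r : r ≤ cᵢ + v → grd C′ (cᵢ + v) ≤ suc (grd C′ v)
      reaches-r r≤ = begin
        grd C′ (cᵢ + v)      ≡⟨ cong (grd C′) (cᵢ+v≡r r≤) ⟩
        grd C′ r             ≡⟨ cong (grd C′) r≡q+p₀ ⟩
        grd C′ (q + p₀)      ≡⟨ grd-topCoin-+ C′ p₀ ⟩
        suc (grd C′ p₀)      ≤⟨ s≤s (≤-trans grd-p₀≤ 1+a₁≤grd) ⟩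
        suc (grd C′ (p + a₁)) ≡⟨ cong (λ u → suc (grd C′ u)) (v≡p+a₁ r≤) ⟨
        suc (grd C′ v)       ∎

  p₀<r : p₀ < r
  p₀<r = subst (_≤ r) p≡1+p₀ (<⇒≤ (<-trans p<q q<r))

  -- For a > 2 the number s = 2p − q is a coin, and p − 1 = s + (a − 2).
  a₁≡0 : a₁ ≡ 0
  a₁≡0 = n≤0⇒n≡0 (≮⇒≥ λ a₁>0 → <⇒≱ grd-p₀>1+a₁ (grd-p₀≤ a₁>0))
    where
    open +-*-Solver
    s = p₀ ∸ a₁
    a₁<p₀ : a₁ < p₀
    a₁<p₀ = s≤s⁻¹ (subst₂ _≤_ a≡2+a₁ p≡1+p₀ (<⇒≤ a<p))
    p₀≡s+a₁ : p₀ ≡ s + a₁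
    p₀≡s+a₁ = sym (m∸n+n≡m (<⇒≤ a₁<p₀))
    s>0 : s > 0
    s>0 = m<n⇒0<n∸m a₁<p₀
    p+p≡q+s : p + p ≡ q + s
    p+p≡q+s = begin
      p + p               ≡⟨ cong (p +_) (trans p≡1+p₀ (cong suc p₀≡s+a₁)) ⟩
      p + suc (s + a₁)    ≡⟨ solve 3 (λ p s x → p :+ (con 1 :+ (s :+ x)) := con 1 :+ (p :+ x) :+ s) refl p s a₁ ⟩
      suc (p + a₁) + s    ≡⟨ cong (_+ s) q≡1+p+a₁ ⟨
      q + s               ∎
      where open ≡-Reasoning
    grd-p₀≤ : a₁ > 0 → grd C′ p₀ ≤ suc a₁
    grd-p₀≤ a₁>0 = go (grd≤1⇒coin C s>0 grd-s≤1)
      where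
      open ≤-Reasoning
      -- As `r = 2p + a₁`, this is where `a₁ > 0` enters. It makes the greedy payment of `2p` in `C`
      -- start with `q` and leave `s`.
      p+p<r : p + p < r
      p+p<r = subst (p + p <_) (sym r≡p+[p+a₁]) (+-monoʳ-< p (m<m+n p a₁>0))
      s<r : s < r
      s<r = ≤-<-trans (≤-trans (m≤n+m s q) (≤-reflexive (sym p+p≡q+s))) p+p<r
      grd-s≤1 : grd C s ≤ 1
      grd-s≤1 = s≤s⁻¹ (begin
        suc (grd C s)   ≡⟨ cong suc (grd-initSubsystem C s<r) ⟩
        suc (grd C′ s)  ≡⟨ grd-topCoin-+ C′ s ⟨
        grd C′ (q + s)  ≡⟨ cong (grd C′) p+p≡q+s ⟨
        grd C′ (p + p)  ≡⟨ grd-initSubsystem C p+p<r ⟨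
        grd C (p + p)   ≤⟨ pair≤2 iₚ iₚ ⟩
        2               ∎)
      go : ∃[ i ] coin C i ≡ s → grd C′ p₀ ≤ suc a₁
      go (i , c≡s) = begin
        grd C′ p₀              ≡⟨ grd-initSubsystem C p₀<r ⟨
        grd C p₀               ≡⟨ cong (grd C) (trans p₀≡s+a₁ (cong (_+ a₁) (sym c≡s))) ⟩
        grd C (coin C i + a₁)  ≤⟨ sub i a₁ ⟩
        suc (grd C a₁)         ≤⟨ s≤s (grd≤ C a₁) ⟩
        suc a₁                 ∎

  q≡1+p : q ≡ suc p
  q≡1+p = trans q≡1+p+a₁ (cong suc (trans (cong (p +_) a₁≡0) (+-identityʳ p)))

  r≡p+p : r ≡ p + p
  r≡p+p = trans r≡p+[p+a₁] (cong (p +_) (trans (cong (p +_) a₁≡0) (+-identityʳ p)))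

  -- A coin t with 2 ≤ t < p has t + p = q + (t − 1), so t − 1 is a coin as well.
  consecutive : ∀ j → coin C (suc j) < p → coin C (suc j) ≡ suc (coin C (inject₁ j))
  consecutive j t<p = ≤-antisym t≤1+c (coin-mono-< C (s≤s (≤-reflexive (toℕ-inject₁ j))))
    where
    open ≤-Reasoning
    t = coin C (suc j)
    t₀ = t ∸ 1
    1<t : 1 < t
    1<t = subst (_< t) (proj₁ (isSystem C)) (coin-mono-< C (s≤s z≤n))
    t≡1+t₀ : t ≡ suc t₀
    t≡1+t₀ = sym (m+[n∸m]≡n (<⇒≤ 1<t))
    q+t₀≡t+p : q + t₀ ≡ t + p
    q+t₀≡t+p = trans (cong (_+ t₀) q≡1+p) (trans (sym (+-suc p t₀))
      (trans (cong (p +_) (sym t≡1+t₀)) (+-comm p t)))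
    t+p<r : t + p < r
    t+p<r = subst (t + p <_) (sym r≡p+p) (+-monoˡ-< p t<p)
    grd-t₀≤1 : grd C t₀ ≤ 1
    grd-t₀≤1 = s≤s⁻¹ (begin
      suc (grd C t₀)   ≡⟨ cong suc (grd-initSubsystem C (≤-<-trans (≤-trans (m∸n≤m t 1) (m≤m+n t p)) t+p<r)) ⟩
      suc (grd C′ t₀)  ≡⟨ grd-topCoin-+ C′ t₀ ⟨
      grd C′ (q + t₀)  ≡⟨ cong (grd C′) q+t₀≡t+p ⟩
      grd C′ (t + p)   ≡⟨ grd-initSubsystem C t+p<r ⟨
      grd C (t + p)    ≤⟨ pair≤2 (suc j) iₚ ⟩
      2                ∎)
    -- The coin `t₀` lies below `t`, so its index is at most that of the predecessor of `t`, and the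
    -- gap before `t` is at most 1.
    bound : ∃[ k ] coin C k ≡ t₀ → t ≤ suc (coin C (inject₁ j))
    bound (k , c≡t₀) = begin
      t                          ≡⟨ t≡1+t₀ ⟩
      suc t₀                     ≡⟨ cong suc c≡t₀ ⟨
      suc (coin C k)             ≤⟨ s≤s (coin-mono-≤ C k≤j) ⟩
      suc (coin C (inject₁ j))   ∎
      where
      k<1+j : k Fin.< suc j
      k<1+j = coin-cancel-< C (≤-reflexive (trans (cong suc c≡t₀) (sym t≡1+t₀)))
      k≤j : k Fin.≤ inject₁ j
      k≤j = subst (toℕ k ≤_) (sym (toℕ-inject₁ j)) (s≤s⁻¹ k<1+j)
    t≤1+c : t ≤ suc (coin C (inject₁ j))
    t≤1+c = bound (grd≤1⇒coin C (m<n⇒0<n∸m 1<t) grd-t₀≤1)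

  coin<p : ∀ i → coin C i < p → coin C i ≡ suc (toℕ i)
  coin<p = <-weakInduction _ (λ _ → proj₁ (isSystem C)) step
    where
    step : ∀ j → (coin C (inject₁ j) < p → coin C (inject₁ j) ≡ suc (toℕ (inject₁ j))) →
           coin C (suc j) < p → coin C (suc j) ≡ suc (toℕ (suc j))
    step j ih t<p = trans t≡ (cong suc (trans (ih (<-trans (≤-reflexive (sym t≡)) t<p))
      (cong suc (toℕ-inject₁ j))))
      where
      t≡ = consecutive j t<p

  coin‴ : ∀ i → coin C‴ i ≡ suc (toℕ i)
  coin‴ i = trans (coin<p (inject₁ (inject₁ (inject₁ i)))
      (≤-<-trans (coin≤topCoin C‴ i) (topCoin-initSubsystem-< C″)))
    (cong suc (trans (toℕ-inject₁ _) (trans (toℕ-inject₁ _) (toℕ-inject₁ i))))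

  -- The coins below `p` end at `2 + m`. If `p` were `3 + m`, then `p₀` would be the last of them
  -- and cost one coin, against `grd-p₀>1+a₁`.
  p>3+m : p > 3 + m
  p>3+m = ≤∧≢⇒< 3+m≤p λ 3+m≡p → <⇒≱ grd-p₀>1+a₁ (grd-p₀≤ 3+m≡p)
    where
    open ≤-Reasoning
    top : topCoin C‴ ≡ 2 + m
    top = trans (coin‴ (fromℕ (1 + m))) (cong suc (toℕ-fromℕ (1 + m)))
    3+m≤p : 3 + m ≤ p
    3+m≤p = subst (_< p) top (topCoin-initSubsystem-< C″)
    grd-p₀≤ : 3 + m ≡ p → grd C′ p₀ ≤ suc a₁
    grd-p₀≤ 3+m≡p = begin
      grd C′ p₀              ≡⟨ grd-initSubsystem C p₀<r ⟨
      grd C p₀               ≡⟨ cong (grd C) (suc-injective (trans (sym p≡1+p₀) (sym 3+m≡p))) ⟩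
      grd C (2 + m)          ≡⟨ cong (grd C) top ⟨
      grd C (topCoin C‴)     ≡⟨ grd-coin C _ ⟩
      1                      ≤⟨ s≤s z≤n ⟩
      suc a₁                 ∎

-- Sufficiency of the shape

module Consecutive (C : System (suc n)) (coin≡ : ∀ i → coin C i ≡ suc (toℕ i)) where

  topCoin≡ : topCoin C ≡ suc n
  topCoin≡ = trans (coin≡ (fromℕ n)) (cong suc (toℕ-fromℕ n))

  grd-+ : ∀ v → grd C (suc n + v) ≡ suc (grd C v)
  grd-+ v = trans (cong (λ k → grd C (k + v)) (sym topCoin≡)) (grd-topCoin-+ C v)

  grd≤1 : ∀ {v} → v ≤ suc n → grd C v ≤ 1
  grd≤1 {zero}  _   = ≤-trans (≤-reflexive (grd-0 C)) z≤n
  grd≤1 {suc v} v<n = ≤-reflexive (trans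
    (cong (grd C) (sym (trans (coin≡ (fromℕ< v<n)) (cong suc (toℕ-fromℕ< v<n)))))
    (grd-coin C (fromℕ< v<n)))

  -- Here `grd C v` is `v / (n + 1)` rounded up. Below the largest coin the left side is at most 1
  -- and the right side positive; from there on, removing that coin lowers both sides by 1.
  grd-≤-suc : ∀ v → grd C v ≤ grd C (suc v)
  grd-≤-suc = <-rec (λ v → grd C v ≤ grd C (suc v)) step
    where
    open ≤-Reasoning
    step : ∀ v → (∀ {u} → u < v → grd C u ≤ grd C (suc u)) → grd C v ≤ grd C (suc v)
    step v rec = [ below , above ]′ (<-≤-connex v (suc n))
      where
      below : v < suc n → grd C v ≤ grd C (suc v)
      below v<n = ≤-trans (grd≤1 (<⇒≤ v<n)) (grd-positive C z<s)
      above : suc n ≤ v → grd C v ≤ grd C (suc v)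
      above n≤v = begin
        grd C v               ≡⟨ cong (grd C) v≡ ⟩
        grd C (suc n + u)     ≡⟨ grd-+ u ⟩
        suc (grd C u)         ≤⟨ s≤s (rec (subst (u <_) (sym v≡) (m<n+m u z<s))) ⟩
        suc (grd C (suc u))   ≡⟨ grd-+ (suc u) ⟨
        grd C (suc n + suc u) ≡⟨ cong (grd C) (trans (+-suc (suc n) u) (cong suc (sym v≡))) ⟩
        grd C (suc v)         ∎
        where
        u = v ∸ suc n
        v≡ : v ≡ suc n + u
        v≡ = sym (m+[n∸m]≡n n≤v)

  grd-mono-≤ : ∀ {u v} → u ≤ v → grd C u ≤ grd C v
  grd-mono-≤ u≤v = go (≤⇒≤′ u≤v)
    where
    go : ∀ {u v} → u ≤′ v → grd C u ≤ grd C v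
    go ≤′-refl        = ≤-refl
    go (≤′-step u≤′v) = ≤-trans (go u≤′v) (grd-≤-suc _)

  grd-≤-1+ : ∀ {u v} → u ≤ suc n + v → grd C u ≤ suc (grd C v)
  grd-≤-1+ u≤ = ≤-trans (grd-mono-≤ u≤) (≤-reflexive (grd-+ _))

-- The system (1, ..., k, p, p + 1, 2p)

module Backward {m : ℕ} (C : System (5 + m))
  (coin‴ : ∀ i → coin (initSubsystem (initSubsystem (initSubsystem C))) i ≡ suc (toℕ i))
  (q≡1+p : topCoin (initSubsystem C) ≡ suc (topCoin (initSubsystem (initSubsystem C))))
  (r≡p+p : topCoin C ≡ topCoin (initSubsystem (initSubsystem C)) + topCoin (initSubsystem (initSubsystem C)))
  (3+m<p : 3 + m < topCoin (initSubsystem (initSubsystem C))) where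

  C′ = initSubsystem C
  C″ = initSubsystem C′
  C‴ = initSubsystem C″

  p = topCoin C″
  q = topCoin C′
  r = topCoin C
  k = 2 + m

  G = grd C
  H = grd C‴

  open Consecutive C‴ coin‴

  p<q : p < q
  p<q = topCoin-initSubsystem-< C′

  q<r : q < r
  q<r = topCoin-initSubsystem-< C

  k<p : k < p
  k<p = <⇒≤ 3+m<p

  G-low : ∀ {v} → v < p → G v ≡ H v
  G-low v<p = trans (grd-initSubsystem C (<-trans v<p (<-trans p<q q<r)))
    (trans (grd-initSubsystem C′ (<-trans v<p p<q)) (grd-initSubsystem C″ v<p))

  -- The truncated difference makes the formula hold at v = p = q − 1 too.
  G-mid : ∀ {v} → p ≤ v → v < r → G v ≡ suc (H (v ∸ q))
  G-mid {v} p≤v v<r = trans (grd-initSubsystem C v<r) ([ at-p , above-p ]′ (<-≤-connex v q))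
    where
    open ≡-Reasoning
    at-p : v < q → grd C′ v ≡ suc (H (v ∸ q))
    at-p v<q = begin
      grd C′ v         ≡⟨ cong (grd C′) (≤-antisym (s≤s⁻¹ (subst (v <_) q≡1+p v<q)) p≤v) ⟩
      grd C′ p         ≡⟨ grd-coin C′ (opposite (suc zero)) ⟩
      1                ≡⟨ cong suc (grd-0 C‴) ⟨
      suc (H 0)        ≡⟨ cong (λ u → suc (H u)) (m≤n⇒m∸n≡0 (<⇒≤ v<q)) ⟨
      suc (H (v ∸ q))  ∎
    above-p : q ≤ v → grd C′ v ≡ suc (H (v ∸ q))
    above-p q≤v = begin
      grd C′ v             ≡⟨ cong (grd C′) (sym v≡) ⟩
      grd C′ (q + u)       ≡⟨ grd-topCoin-+ C′ u ⟩
      suc (grd C′ u)       ≡⟨ cong suc (trans (grd-initSubsystem C′ (<-trans u<p p<q)) (grd-initSubsystem C″ u<p)) ⟩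
      suc (H u)            ∎
      where
      u = v ∸ q
      v≡ : q + u ≡ v
      v≡ = m+[n∸m]≡n q≤v
      u<p : u < p
      u<p = +-cancelˡ-< p u p (≤-<-trans (+-monoˡ-≤ u (<⇒≤ p<q)) (subst₂ _<_ (sym v≡) r≡p+p v<r))

  G-mid-positive : ∀ {v} → p ≤ v → v < r → 1 ≤ G v
  G-mid-positive p≤v v<r = ≤-trans (s≤s z≤n) (≤-reflexive (sym (G-mid p≤v v<r)))

  ≤1+p+[∸q] : ∀ v → v ≤ suc p + (v ∸ q)
  ≤1+p+[∸q] v = subst (λ x → v ≤ x + (v ∸ q)) q≡1+p (m≤n+m∸n v q)

  -- This covers the coins of `C‴`. Within one range of `G`, a shift by `t ≤ k` raises `H` by at
  -- most 1; crossing `p` or `r` is treated separately.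
  G-small : ∀ {t v} → t ≤ k → v < r → G (t + v) ≤ suc (G v)
  G-small {t} {v} t≤k v<r = [ v-low , v-mid ]′ (<-≤-connex v p)
    where
    open ≤-Reasoning
    t<p : t < p
    t<p = ≤-<-trans t≤k k<p
    v-low : v < p → G (t + v) ≤ suc (G v)
    v-low v<p = [ (λ lt → begin
        G (t + v)            ≡⟨ G-low lt ⟩
        H (t + v)            ≤⟨ grd-≤-1+ (+-monoˡ-≤ v t≤k) ⟩
        suc (H v)            ≡⟨ cong suc (G-low v<p) ⟨
        suc (G v)            ∎)
      -- Crossing `p`, one coin is spent and the remainder is at most `v`, because `t ≤ q`.
      , (λ p≤ → begin
        G (t + v)            ≡⟨ G-mid p≤ (subst (t + v <_) (sym r≡p+p) (+-mono-< t<p v<p)) ⟩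
        suc (H (t + v ∸ q))  ≤⟨ s≤s (grd-mono-≤ (m≤n+o⇒m∸n≤o (t + v) q (+-monoˡ-≤ v (<⇒≤ (<-trans t<p p<q))))) ⟩
        suc (H v)            ≡⟨ cong suc (G-low v<p) ⟨
        suc (G v)            ∎) ]′ (<-≤-connex (t + v) p)
    v-mid : p ≤ v → G (t + v) ≤ suc (G v)
    v-mid p≤v = [ (λ lt → begin
        G (t + v)                ≡⟨ G-mid (≤-trans p≤v (m≤n+m v t)) lt ⟩
        suc (H (t + v ∸ q))      ≤⟨ s≤s (grd-≤-1+ (m≤n+o⇒m∸n≤o (t + v) q shift)) ⟩
        suc (suc (H (v ∸ q)))    ≡⟨ cong suc (G-mid p≤v v<r) ⟨
        suc (G v)                ∎)
      , wrap ]′ (<-≤-connex (t + v) r)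
      where
      shift : t + v ≤ q + (k + (v ∸ q))
      shift = begin
        t + v               ≤⟨ +-mono-≤ t≤k (m≤n+m∸n v q) ⟩
        k + (q + (v ∸ q))   ≡⟨ solve 3 (λ k q w → k :+ (q :+ w) := q :+ (k :+ w)) refl k q (v ∸ q) ⟩
        q + (k + (v ∸ q))   ∎
        where open +-*-Solver
      -- Past `r` the remainder is at most `t ≤ k`, so two coins suffice, while `v` itself costs at
      -- least one.
      wrap : r ≤ t + v → G (t + v) ≤ suc (G v)
      wrap r≤ = begin
        G (t + v)    ≡⟨ cong G r+u≡ ⟨
        G (r + u)    ≡⟨ grd-topCoin-+ C u ⟩
        suc (G u)    ≡⟨ cong suc (G-low (≤-<-trans u≤k k<p)) ⟩
        suc (H u)    ≤⟨ s≤s (grd≤1 u≤k) ⟩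
        2            ≤⟨ s≤s (G-mid-positive p≤v v<r) ⟩
        suc (G v)    ∎
        where
        u = t + v ∸ r
        r+u≡ : r + u ≡ t + v
        r+u≡ = m+[n∸m]≡n r≤
        u≤k : u ≤ k
        u≤k = ≤-trans (m≤n+o⇒m∸n≤o (t + v) r (≤-trans (+-monoʳ-≤ t (<⇒≤ v<r)) (≤-reflexive (+-comm t r)))) t≤k

  -- For `v < p` the sum stays below `r`, and after one coin at most `v` remains. For `v ≥ p`,
  -- `r = 2p` gives `p + v = r + (v − p)`, and `v − p` exceeds `v ∸ q` by at most 1.
  G-p : ∀ {v} → v < r → G (p + v) ≤ suc (G v)
  G-p {v} v<r = [ v-low , v-mid ]′ (<-≤-connex v p)
    where
    open ≤-Reasoning
    v-low : v < p → G (p + v) ≤ suc (G v)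
    v-low v<p = begin
      G (p + v)            ≡⟨ G-mid (m≤m+n p v) (subst (p + v <_) (sym r≡p+p) (+-monoʳ-< p v<p)) ⟩
      suc (H (p + v ∸ q))  ≤⟨ s≤s (grd-mono-≤ (m≤n+o⇒m∸n≤o (p + v) q (+-monoˡ-≤ v (<⇒≤ p<q)))) ⟩
      suc (H v)            ≡⟨ cong suc (G-low v<p) ⟨
      suc (G v)            ∎
    v-mid : p ≤ v → G (p + v) ≤ suc (G v)
    v-mid p≤v = begin
      G (p + v)              ≡⟨ cong (λ w → G (p + w)) p+u≡v ⟨
      G (p + (p + u))        ≡⟨ cong G (trans (sym (+-assoc p p u)) (cong (_+ u) (sym r≡p+p))) ⟩
      G (r + u)              ≡⟨ grd-topCoin-+ C u ⟩
      suc (G u)              ≡⟨ cong suc (G-low u<p) ⟩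
      suc (H u)              ≤⟨ s≤s (grd-≤-1+ (≤-trans u≤ (+-monoˡ-≤ (v ∸ q) (s≤s z≤n)))) ⟩
      suc (suc (H (v ∸ q)))  ≡⟨ cong suc (G-mid p≤v v<r) ⟨
      suc (G v)              ∎
      where
      u = v ∸ p
      p+u≡v : p + u ≡ v
      p+u≡v = m+[n∸m]≡n p≤v
      u<p : u < p
      u<p = +-cancelˡ-< p u p (subst₂ _<_ (sym p+u≡v) r≡p+p v<r)
      u≤ : u ≤ 1 + (v ∸ q)
      u≤ = m≤n+o⇒m∸n≤o v p (≤-trans (≤1+p+[∸q] v) (≤-reflexive (sym (+-suc p (v ∸ q)))))

  -- Below `r` the greedy algorithm pays `q` and then `v`. Otherwise `q + v = r + u` with
  -- `p + u = v + 1`, and the claim becomes `G u ≤ G v`.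
  G-q : ∀ {v} → v < r → G (q + v) ≤ suc (G v)
  G-q {v} v<r = [ below-r , above-r ]′ (<-≤-connex (q + v) r)
    where
    open ≤-Reasoning
    below-r : q + v < r → G (q + v) ≤ suc (G v)
    below-r lt = begin
      G (q + v)            ≡⟨ G-mid (≤-trans (<⇒≤ p<q) (m≤m+n q v)) lt ⟩
      suc (H (q + v ∸ q))  ≡⟨ cong (λ u → suc (H u)) (m+n∸m≡n q v) ⟩
      suc (H v)            ≡⟨ cong suc (G-low v<p) ⟨
      suc (G v)            ∎
      where
      v<p : v < p
      v<p = +-cancelˡ-< p v p (≤-<-trans (+-monoˡ-≤ v (<⇒≤ p<q)) (subst (q + v <_) r≡p+p lt))
    above-r : r ≤ q + v → G (q + v) ≤ suc (G v)
    above-r r≤ = begin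
      G (q + v)    ≡⟨ cong G r+u≡ ⟨
      G (r + u)    ≡⟨ grd-topCoin-+ C u ⟩
      suc (G u)    ≤⟨ s≤s Gu≤Gv ⟩
      suc (G v)    ∎
      where
      u = q + v ∸ r
      r+u≡ : r + u ≡ q + v
      r+u≡ = m+[n∸m]≡n r≤
      p+u≡1+v : p + u ≡ suc v
      p+u≡1+v = +-cancelˡ-≡ p _ _ (trans (sym (+-assoc p p u)) (trans (cong (_+ u) (sym r≡p+p))
        (trans r+u≡ (trans (cong (_+ v) q≡1+p) (sym (+-suc p v))))))
      Gu≤Gv : G u ≤ G v
      Gu≤Gv = [ u-zero , u-positive ]′ (<-≤-connex u 1)
        where
        -- Here `v = p − 1`, which is outside the range of `G-mid`.
        u-zero : u < 1 → G u ≤ G v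
        u-zero u<1 = ≤-trans (≤-reflexive (trans (cong G (n<1⇒n≡0 u<1)) (grd-0 C))) z≤n
        u-positive : 1 ≤ u → G u ≤ G v
        u-positive 1≤u = [ u<p-case , u≡p-case ]′ (m≤n⇒m<n∨m≡n u≤p)
          where
          u≤p : u ≤ p
          u≤p = +-cancelˡ-≤ p u p (subst₂ _≤_ (sym p+u≡1+v) r≡p+p v<r)
          p≤v : p ≤ v
          p≤v = s≤s⁻¹ (subst₂ _≤_ (+-comm p 1) p+u≡1+v (+-monoʳ-≤ p 1≤u))
          u≤ : u ≤ 2 + (v ∸ q)
          u≤ = +-cancelˡ-≤ p _ _ (begin
            p + u               ≡⟨ p+u≡1+v ⟩
            suc v               ≤⟨ s≤s (≤1+p+[∸q] v) ⟩
            2 + p + (v ∸ q)     ≡⟨ solve 2 (λ p w → con 2 :+ p :+ w := p :+ (con 2 :+ w)) refl p (v ∸ q) ⟩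
            p + (2 + (v ∸ q))   ∎)
            where open +-*-Solver
          u<p-case : u < p → G u ≤ G v
          u<p-case u<p = begin
            G u              ≡⟨ G-low u<p ⟩
            -- The bound `2 + (v ∸ q)` is at most `k + (v ∸ q)` because `k = 2 + m`; this is where
            -- having at least five coins matters.
            H u              ≤⟨ grd-≤-1+ (≤-trans u≤ (+-monoˡ-≤ (v ∸ q) (s≤s (s≤s z≤n)))) ⟩
            suc (H (v ∸ q))  ≡⟨ G-mid p≤v v<r ⟨
            G v              ∎
          -- This happens only for `v = r − 1`; `p` is beyond the range of `G-low` but is a coin.
          u≡p-case : u ≡ p → G u ≤ G v
          u≡p-case u≡p = begin
            G u  ≡⟨ cong G u≡p ⟩
            G p  ≡⟨ grd-coin C (opposite (suc (suc zero))) ⟩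
            1    ≤⟨ G-mid-positive p≤v v<r ⟩
            G v  ∎

  canonical : Canonical C
  canonical = canonical-criterion C (inject₁-fromℕ-elim _ (λ _ → G-q)
    (inject₁-fromℕ-elim _ (λ _ → G-p) λ i _ → G-small (subst (coin C‴ i ≤_) topCoin≡ (coin≤topCoin C‴ i))))

  -- Two coins `p` pay `2p`, whereas the greedy algorithm of `C′` takes `q = p + 1` and leaves
  -- `p − 1`. By `3 + m < p` this remainder exceeds `k`, so it needs at least two more coins.
  noncanonical : Noncanonical C′
  noncanonical can′ = <⇒≱ 2<grd (begin
    grd C′ (p + p)  ≤⟨ canonical⇒subadditive C′ can′ (opposite (suc zero)) p ⟩
    suc (grd C′ p)  ≡⟨ cong suc (grd-coin C′ (opposite (suc zero))) ⟩
    2               ∎)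
    where
    open ≤-Reasoning
    p₀ = p ∸ 1
    p≡1+p₀ : p ≡ suc p₀
    p≡1+p₀ = sym (m+[n∸m]≡n (≤-trans (s≤s z≤n) k<p))
    k<p₀ : k < p₀
    k<p₀ = s≤s⁻¹ (subst (3 + m <_) p≡1+p₀ 3+m<p)
    p₀<p : p₀ < p
    p₀<p = ≤-reflexive (sym p≡1+p₀)
    2<grd : 2 < grd C′ (p + p)
    2<grd = begin
      3                            ≤⟨ s≤s (s≤s (grd-positive C‴ (m<n⇒0<n∸m k<p₀))) ⟩
      suc (suc (H (p₀ ∸ k)))       ≡⟨ cong suc (grd-+ (p₀ ∸ k)) ⟨
      suc (H (k + (p₀ ∸ k)))       ≡⟨ cong (λ u → suc (H u)) (m+[n∸m]≡n (<⇒≤ k<p₀)) ⟩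
      suc (H p₀)                   ≡⟨ cong suc (trans (grd-initSubsystem C′ (<-trans p₀<p p<q)) (grd-initSubsystem C″ p₀<p)) ⟨
      suc (grd C′ p₀)              ≡⟨ grd-topCoin-+ C′ p₀ ⟨
      grd C′ (q + p₀)              ≡⟨ cong (grd C′) q+p₀≡p+p ⟩
      grd C′ (p + p)               ∎
      where
      q+p₀≡p+p : q + p₀ ≡ p + p
      q+p₀≡p+p = trans (cong (_+ p₀) q≡1+p) (trans (sym (+-suc p p₀)) (cong (p +_) (sym p≡1+p₀)))

-- From individual coins to the list form and back

theorem12 : (m : ℕ) →
    let n = 5 + m in
    (C : System n) →
    let c = coin C
        c₂ = c (suc zero)
        cₙ = c (opposite zero)
        cₙ₋₁ = c (opposite (suc zero))
        cₙ₋₂ = c (opposite (suc (suc zero)))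
        C′ = initSubsystem C
    in
    cₙ ≡ 2 * cₙ₋₁ ∸ c₂ →
    (Canonical C × Noncanonical C′)
      ⇔
    (toList c ≡ applyUpTo suc (n ∸ 3) ++ cₙ₋₂ ∷ cₙ₋₂ + 1 ∷ 2 * cₙ₋₂ ∷ []
      × cₙ₋₂ > n ∸ 2)
theorem12 m C r≡2q∸a = mk⇔ to from
  where
  C′ = initSubsystem C
  C″ = initSubsystem C′
  C‴ = initSubsystem C″
  c = coin C
  p = topCoin C″
  q = topCoin C′
  r = topCoin C

  toList-c : toList c ≡ toList (coin C‴) ∷ʳ p ∷ʳ q ∷ʳ r
  toList-c = trans (toList-∷ʳ c) (cong (_∷ʳ r)
    (trans (toList-∷ʳ (coin C′)) (cong (_∷ʳ q) (toList-∷ʳ (coin C″)))))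

  p+p≡2*p : p + p ≡ 2 * p
  p+p≡2*p = cong (p +_) (sym (+-identityʳ p))

  to : Canonical C × Noncanonical C′ →
    toList c ≡ applyUpTo suc (2 + m) ++ p ∷ p + 1 ∷ 2 * p ∷ [] × p > 3 + m
  to (can , non) = toList≡ , F.p>3+m
    where
    module F = Forward C r≡2q∸a can non
    open ≡-Reasoning
    toList≡ : toList c ≡ applyUpTo suc (2 + m) ++ p ∷ p + 1 ∷ 2 * p ∷ []
    toList≡ = begin
      toList c
        ≡⟨ toList-c ⟩
      toList (coin C‴) ∷ʳ p ∷ʳ q ∷ʳ r
        ≡⟨ ∷ʳ³-++ (toList (coin C‴)) p q r ⟩
      toList (coin C‴) ++ p ∷ q ∷ r ∷ []
        ≡⟨ cong₂ (λ xs ys → xs ++ p ∷ ys) (tabulate≡applyUpTo (coin C‴) suc F.coin‴)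
             (cong₂ (λ x y → x ∷ y ∷ []) (trans F.q≡1+p (+-comm 1 p)) (trans F.r≡p+p p+p≡2*p)) ⟩
      applyUpTo suc (2 + m) ++ p ∷ p + 1 ∷ 2 * p ∷ []
        ∎

  from : toList c ≡ applyUpTo suc (2 + m) ++ p ∷ p + 1 ∷ 2 * p ∷ [] × p > 3 + m →
    Canonical C × Noncanonical C′
  from (toList≡ , p>3+m) = B.canonical , B.noncanonical
    where
    snoc≡ : toList (coin C‴) ∷ʳ p ∷ʳ q ∷ʳ r ≡ applyUpTo suc (2 + m) ∷ʳ p ∷ʳ (p + 1) ∷ʳ (2 * p)
    snoc≡ = trans (sym toList-c) (trans toList≡
      (sym (∷ʳ³-++ (applyUpTo suc (2 + m)) p (p + 1) (2 * p))))
    -- Comparing the lists from the right yields `r = 2p`, then `q = p + 1`, and finally the coins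
    -- of `C‴`.
    split₁ = ∷ʳ-injective (toList (coin C‴) ∷ʳ p ∷ʳ q) (applyUpTo suc (2 + m) ∷ʳ p ∷ʳ (p + 1)) snoc≡
    split₂ = ∷ʳ-injective (toList (coin C‴) ∷ʳ p) (applyUpTo suc (2 + m) ∷ʳ p) (proj₁ split₁)
    split₃ = ∷ʳ-injective (toList (coin C‴)) (applyUpTo suc (2 + m)) (proj₁ split₂)
    module B = Backward C
      (tabulate≡applyUpTo⁻¹ (coin C‴) suc (proj₁ split₃))
      (trans (proj₂ split₂) (+-comm p 1))
      (trans (proj₂ split₁) (sym p+p≡2*p))
      p>3+m
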